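{- An element $x$ of a continuous dcpo $D$ is sharp if and only if the filter of Scott open neighbourhoods of $x$ is located in the poset of Scott opens of $D$ (ordered by inclusion).
   Context: Everything is constructive: neither excluded middle nor choice is assumed. A subset $S$ of a poset is directed if it is inhabited and any two elements of $S$ have an upper bound in $S$. A dcpo is a poset $(D,\sqsubseteq)$ in which every directed subset $S$ has a supremum $\bigsqcup S$. In a dcpo (in particular in the poset of Scott opens of $D$ ordered by inclusion), $x\ll y$ ($x$ is way below $y$) means that for every directed $S$ with $y\sqsubseteq\bigsqcup S$ there is $s\in S$ with $x\sqsubseteq s$. $D$ is continuous if for every $x$ the set $\{y\in D\mid y\ll x\}$ is directed with supremum $x$. A subset $U\subseteq D$ is Scott open if it is an upper set and whenever $\bigsqcup S\in U$ with $S$ directed, some $s\in S$ is in $U$. An element $x\in D$ is sharp if for every $y,z\in D$ with $y\ll z$ we have $y\ll x$ or $\lnot(z\sqsubseteq x)$. A subset $V$ of a poset $S$ is located if for every $s,t\in S$ with $s\ll t$, we have $t\in V$ or $s\notin V$. -}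

module Defs where

open import Data.Empty.Polymorphic using (⊥)
open import Data.Product using (∃; _×_; _,_; proj₁; proj₂)
open import Data.Sum using (_⊎_)
open import Level using (Level; suc)
open import Relation.Binary.Bundles using (Poset)
open import Relation.Nullary.Negation using (¬_)

-- The ambient logic is intuitionistic and has power sets, but neither excluded
-- middle nor choice.  Plain `Set c` has no power sets, and Σ and ⊎ carry
-- witnesses, so we work over an arbitrary set Ω of truth values (as in a topos).
-- El P is the type of proofs of P, and ⌊ A ⌋ is the truth value "A is
-- inhabited".  The point is that Ω lives in the same universe as the types it
-- describes, so that X → Ω is again a type of that universe.
record TruthValues (c : Level) : Set (suc c) where
  field
    Ω       : Set c
    El      : Ω → Set c
    ⌊_⌋     : Set c → Ω
    ⌊⌋-in   : {A : Set c} → A → El ⌊ A ⌋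
    ⌊⌋-elim : {A : Set c} {P : Ω} → (A → El P) → El ⌊ A ⌋ → El P
    ⌊⊥⌋-out : ¬ El ⌊ ⊥ ⌋

module DomainTheory {c : Level} (𝕋 : TruthValues c) where
  open TruthValues 𝕋 public

  infix 4 _∈_

  -- Propositional truncation: ∥ ∃ P ∥ is mere existence and ∥ A ⊎ B ∥ is
  -- disjunction without a decision procedure.
  ∥_∥ : Set c → Set c
  ∥ A ∥ = El ⌊ A ⌋

  -- Subsets of a poset need not respect its equality ≈.  Closing a subset under
  -- ≈ changes neither its directedness nor its suprema, and Scott opens respect ≈
  -- because they are upper sets.
  Subset : Set c → Set c
  Subset X = X → Ω

  _∈_ : {X : Set c} → X → Subset X → Set c
  x ∈ S = El (S x)

  module _ (P : Poset c c c) where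
    open Poset P using (Carrier) renaming (_≤_ to _⊑_)

    IsDirected : Subset Carrier → Set c
    IsDirected S =
      ∥ ∃ (λ s → s ∈ S) ∥ ×
      (∀ s t → s ∈ S → t ∈ S → ∥ ∃ (λ u → u ∈ S × s ⊑ u × t ⊑ u) ∥)

    IsSupremum : Subset Carrier → Carrier → Set c
    IsSupremum S u =
      (∀ s → s ∈ S → s ⊑ u) ×
      (∀ v → (∀ s → s ∈ S → s ⊑ v) → u ⊑ v)

    IsDirectedComplete : Set c
    IsDirectedComplete = ∀ S → IsDirected S → ∥ ∃ (λ u → IsSupremum S u) ∥

    -- Suprema are unique up to the equality of the poset, so ⨆ S is rendered by
    -- quantifying over all u with IsSupremum S u.
    WayBelow : Carrier → Carrier → Set c
    WayBelow x y =
      ∀ S u → IsDirected S → IsSupremum S u → y ⊑ u → ∥ ∃ (λ s → s ∈ S × x ⊑ s) ∥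

    IsScottOpen : Subset Carrier → Set c
    IsScottOpen U =
      (∀ x y → x ⊑ y → x ∈ U → y ∈ U) ×
      (∀ S u → IsDirected S → IsSupremum S u → u ∈ U → ∥ ∃ (λ s → s ∈ S × s ∈ U) ∥)

    IsLocated : Subset Carrier → Set c
    IsLocated V = ∀ s t → WayBelow s t → ∥ t ∈ V ⊎ ¬ s ∈ V ∥

  record Dcpo : Set (suc c) where
    field
      poset            : Poset c c c
      directedComplete : IsDirectedComplete poset

    open Poset poset public using (Carrier) renaming (_≤_ to _⊑_)

    _≪_ : Carrier → Carrier → Set c
    _≪_ = WayBelow poset

  module _ (D : Dcpo) where
    open Dcpo D

    ↡ : Carrier → Subset Carrier
    ↡ x y = ⌊ y ≪ x ⌋

    IsContinuous : Set c
    IsContinuous = ∀ x → IsDirected poset (↡ x) × IsSupremum poset (↡ x) x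

    IsSharp : Carrier → Set c
    IsSharp x = ∀ y z → y ≪ z → ∥ y ≪ x ⊎ ¬ (z ⊑ x) ∥

    record ScottOpen : Set c where
      field
        subset      : Subset Carrier
        isScottOpen : IsScottOpen poset subset

    open ScottOpen

    -- Two Scott opens are equal when they have the same elements.
    scottOpenPoset : Poset c c c
    scottOpenPoset = record
      { Carrier = ScottOpen
      ; _≈_     = λ U V → (U ⊆ V) × (V ⊆ U)
      ; _≤_     = _⊆_
      ; isPartialOrder = record
        { isPreorder = record
          { isEquivalence = record
            { refl  = (λ _ p → p) , (λ _ p → p)
            ; sym   = λ (f , g) → g , f
            ; trans = λ (f , g) (h , k) →
                (λ x p → h x (f x p)) , (λ x p → g x (k x p))
            }
          ; reflexive = proj₁
          ; trans     = λ f g x p → g x (f x p)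
          }
        ; antisym = _,_
        }
      }
      where
      _⊆_ : ScottOpen → ScottOpen → Set c
      U ⊆ V = ∀ x → x ∈ subset U → x ∈ subset V

    scottOpenUnion : Subset ScottOpen → ScottOpen
    scottOpenUnion 𝓢 = record
      { subset      = λ x → ⌊ ∃ (λ U → U ∈ 𝓢 × x ∈ subset U) ⌋
      ; isScottOpen =
          (λ x y x⊑y → ⌊⌋-elim λ (U , U∈𝓢 , x∈U) →
            ⌊⌋-in (U , U∈𝓢 , proj₁ (isScottOpen U) x y x⊑y x∈U))
        , (λ S u dir sup → ⌊⌋-elim λ (U , U∈𝓢 , u∈U) →
            ⌊⌋-elim (λ (s , s∈S , s∈U) → ⌊⌋-in (s , s∈S , ⌊⌋-in (U , U∈𝓢 , s∈U)))
              (proj₂ (isScottOpen U) S u dir sup u∈U))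
      }

    scottOpenDcpo : Dcpo
    scottOpenDcpo = record
      { poset            = scottOpenPoset
      ; directedComplete = λ 𝓢 _ → ⌊⌋-in
          ( scottOpenUnion 𝓢
          , (λ U U∈𝓢 x x∈U → ⌊⌋-in (U , U∈𝓢 , x∈U))
          , (λ V bound x → ⌊⌋-elim λ (U , U∈𝓢 , x∈U) → bound U U∈𝓢 x x∈U))
      }

    scottOpenNeighbourhoods : Carrier → Subset ScottOpen
    scottOpenNeighbourhoods x U = subset U x

{-# OPTIONS --safe #-}
module Submission where

-- If x is sharp and V is Scott open, the Scott opens W with "x ∈ V or x ∉ W"
-- form a directed family whose union contains V, so U ≪ V puts U below one of
-- them.  Conversely y ≪ w implies ↟ w ≪ ↟ y, so for an interpolant y ≪ w ≪ z
-- locatedness at ↟ w ≪ ↟ y decides y ≪ x or ¬ (w ≪ x), and the latter refutes z ⊑ x.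

open import Defs
open import Data.Empty using (⊥-elim)
open import Data.Product using (∃; _×_; _,_; proj₁; proj₂)
open import Data.Sum using (_⊎_; inj₁; inj₂)
open import Function.Base using (_∘_)
open import Function.Bundles using (_⇔_; mk⇔)
open import Level using (Level)
open import Relation.Binary.Bundles using (Poset)
open import Relation.Nullary.Negation using (¬_)

module Truncation {c : Level} (𝕋 : TruthValues c) where
  open DomainTheory 𝕋

  _>>=_ : {A : Set c} {P : Ω} → ∥ A ∥ → (A → El P) → El P
  a >>= f = ⌊⌋-elim f a

  ∥∥-map : {A B : Set c} → (A → B) → ∥ A ∥ → ∥ B ∥
  ∥∥-map f = ⌊⌋-elim (⌊⌋-in ∘ f)

  ¬-∥∥ : {A : Set c} → ¬ A → ¬ ∥ A ∥
  ¬-∥∥ ¬a a = ⌊⊥⌋-out (∥∥-map (⊥-elim ∘ ¬a) a)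

module WayBelowProperties {c : Level} (𝕋 : TruthValues c) (P : Poset c c c) where
  open DomainTheory 𝕋
  open Truncation 𝕋
  open Poset P using (trans) renaming (_≤_ to _⊑_)

  private
    _≪_ = WayBelow P

  ≪-⊑-trans : ∀ {x y z} → x ≪ y → y ⊑ z → x ≪ z
  ≪-⊑-trans x≪y y⊑z S u dir sup z⊑u = x≪y S u dir sup (trans y⊑z z⊑u)

  ⊑-≪-trans : ∀ {x y z} → x ⊑ y → y ≪ z → x ≪ z
  ⊑-≪-trans x⊑y y≪z S u dir sup z⊑u = do
    (s , s∈S , y⊑s) ← y≪z S u dir sup z⊑u
    ⌊⌋-in (s , s∈S , trans x⊑y y⊑s)

module ContinuousDcpo
  {c : Level} (𝕋 : TruthValues c)
  (D : DomainTheory.Dcpo 𝕋) (continuous : DomainTheory.IsContinuous 𝕋 D)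
  where

  open DomainTheory 𝕋
  open Truncation 𝕋
  open Dcpo D
  open Poset poset using (refl)
  open WayBelowProperties 𝕋 poset
  open ScottOpen

  ↡-directed : ∀ x → IsDirected poset (↡ D x)
  ↡-directed x = proj₁ (continuous x)

  ↡-supremum : ∀ x → IsSupremum poset (↡ D x) x
  ↡-supremum x = proj₂ (continuous x)

  -- Serves `interpolation`: each member comes, up to truncation, with an element strictly between
  -- it and `z` in the way-below relation.
  ↡² : Carrier → Subset Carrier
  ↡² z a = ⌊ ∃ (λ b → a ≪ b × b ≪ z) ⌋

  ↡²-directed : ∀ z → IsDirected poset (↡² z)
  ↡²-directed z = inhabited , upperBound
    where
    inhabited : ∥ ∃ (λ a → a ∈ ↡² z) ∥
    inhabited = do
      (b , b∈↡z) ← proj₁ (↡-directed z)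
      (a , a∈↡b) ← proj₁ (↡-directed b)
      b≪z ← b∈↡z
      a≪b ← a∈↡b
      ⌊⌋-in (a , ⌊⌋-in (b , a≪b , b≪z))

    upperBound : ∀ a a′ → a ∈ ↡² z → a′ ∈ ↡² z →
                 ∥ ∃ (λ d → d ∈ ↡² z × a ⊑ d × a′ ⊑ d) ∥
    upperBound a a′ a∈ a′∈ = do
      (b , a≪b , b≪z) ← a∈
      (b′ , a′≪b′ , b′≪z) ← a′∈
      -- Bounding the intermediate elements first puts `a` and `a′` in the same directed set
      -- `↡ D e`.
      (e , e∈↡z , b⊑e , b′⊑e) ← proj₂ (↡-directed z) b b′ (⌊⌋-in b≪z) (⌊⌋-in b′≪z)
      (d , d∈↡e , a⊑d , a′⊑d) ← proj₂ (↡-directed e) a a′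
        (⌊⌋-in (≪-⊑-trans a≪b b⊑e)) (⌊⌋-in (≪-⊑-trans a′≪b′ b′⊑e))
      e≪z ← e∈↡z
      d≪e ← d∈↡e
      ⌊⌋-in (d , ⌊⌋-in (e , d≪e , e≪z) , a⊑d , a′⊑d)

  ∈↡⇒⊑ : ∀ {x y} → y ∈ ↡ D x → y ⊑ x
  ∈↡⇒⊑ {x} {y} = proj₁ (↡-supremum x) y

  -- ⊑ need not be El of a truth value, so a truncated y ≪ x yields y ⊑ x only
  -- because x is an upper bound of ↡ x.
  ↡²-supremum : ∀ z → IsSupremum poset (↡² z) z
  ↡²-supremum z = upper , least
    where
    upper : ∀ a → a ∈ ↡² z → a ⊑ z
    upper a = ∈↡⇒⊑ ∘ ∥∥-map λ (b , a≪b , b≪z) → ≪-⊑-trans a≪b (∈↡⇒⊑ (⌊⌋-in b≪z))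

    least : ∀ v → (∀ a → a ∈ ↡² z → a ⊑ v) → z ⊑ v
    least v bound = proj₂ (↡-supremum z) v λ b b∈↡z →
      proj₂ (↡-supremum b) v λ a a∈↡b → bound a do
        b≪z ← b∈↡z
        a≪b ← a∈↡b
        ⌊⌋-in (b , a≪b , b≪z)

  -- Since `↡² z` is directed with supremum `z`, `y ≪ z` places `y` below a member `a`, and the
  -- element between `a` and `z` interpolates.
  interpolation : ∀ {y z} → y ≪ z → ∥ ∃ (λ w → y ≪ w × w ≪ z) ∥
  interpolation {z = z} y≪z = do
    (a , a∈↡²z , y⊑a) ← y≪z (↡² z) z (↡²-directed z) (↡²-supremum z) refl
    (b , a≪b , b≪z) ← a∈↡²z
    ⌊⌋-in (b , ⊑-≪-trans y⊑a a≪b , b≪z)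

  ↟ : Carrier → ScottOpen D
  ↟ y .subset x = ⌊ y ≪ x ⌋
  ↟ y .isScottOpen =
      (λ x x′ x⊑x′ → ∥∥-map λ y≪x → ≪-⊑-trans y≪x x⊑x′)
    , (λ S u dir sup u∈↟y → do
        y≪u ← u∈↟y
        -- Applying `y ≪ u` directly to `S` would give only `y ⊑ s`; the interpolant strengthens
        -- this to `y ≪ s`.
        (w , y≪w , w≪u) ← interpolation y≪u
        (s , s∈S , w⊑s) ← w≪u S u dir sup refl
        ⌊⌋-in (s , s∈S , ⌊⌋-in (≪-⊑-trans y≪w w⊑s)))

  private
    module 𝒪 = Dcpo (scottOpenDcpo D)

  scottOpenUnion-supremum : ∀ 𝓢 → IsSupremum 𝒪.poset 𝓢 (scottOpenUnion D 𝓢)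
  scottOpenUnion-supremum 𝓢 =
      (λ U U∈𝓢 x x∈U → ⌊⌋-in (U , U∈𝓢 , x∈U))
    , (λ V bound x x∈⋃ → do
        (U , U∈𝓢 , x∈U) ← x∈⋃
        bound U U∈𝓢 x x∈U)

  -- The point `w` lies in `↟ y`, so a single member of the family contains `w`, and as an upper set
  -- it then contains all of `↟ w`.
  ↟-reverses-≪ : ∀ {y w} → y ≪ w → ↟ w 𝒪.≪ ↟ y
  ↟-reverses-≪ {y} {w} y≪w 𝓢 O _ sup ↟y⊑O = do
    -- `O` is an arbitrary supremum; its leastness against the union exhibits a member containing
    -- `w`.
    (U , U∈𝓢 , w∈U) ← proj₂ sup (scottOpenUnion D 𝓢)
      (proj₁ (scottOpenUnion-supremum 𝓢)) w (↟y⊑O w (⌊⌋-in y≪w))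
    ⌊⌋-in (U , U∈𝓢 , λ x w∈↡x → proj₁ (isScottOpen U) w x (∈↡⇒⊑ w∈↡x) w∈U)

  approximation-in-open : ∀ (V : ScottOpen D) {v} → v ∈ subset V → ∥ ∃ (λ w → w ≪ v × w ∈ subset V) ∥
  approximation-in-open V {v} v∈V = do
    (w , w∈↡v , w∈V) ← proj₂ (isScottOpen V) (↡ D v) v (↡-directed v) (↡-supremum v) v∈V
    w≪v ← w∈↡v
    ⌊⌋-in (w , w≪v , w∈V)

  -- The largest Scott open that misses `x`, hence a common upper bound for any opens missing `x`.
  exterior : Carrier → ScottOpen D
  exterior x = scottOpenUnion D λ O → ⌊ ¬ x ∈ subset O ⌋

  ∉⇒⊑exterior : ∀ {x} O → ¬ x ∈ subset O → O 𝒪.⊑ exterior x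
  ∉⇒⊑exterior O x∉O = proj₁ (scottOpenUnion-supremum _) O (⌊⌋-in x∉O)

  ∉exterior : ∀ x → ¬ x ∈ subset (exterior x)
  ∉exterior x = ¬-∥∥ λ (O , x∉O , x∈O) → ¬-∥∥ (λ x∉O → x∉O x∈O) x∉O

  deciding : Carrier → ScottOpen D → Subset (ScottOpen D)
  deciding x V W = ⌊ x ∈ subset V ⊎ ¬ x ∈ subset W ⌋

  -- Two members either reveal `x ∈ V`, and the union of the family bounds them, or both miss `x`,
  -- and `exterior x` does.
  deciding-directed : ∀ x V → IsDirected 𝒪.poset (deciding x V)
  deciding-directed x V =
      ⌊⌋-in (exterior x , ⌊⌋-in (inj₂ (∉exterior x)))
    , λ W W′ W∈ W′∈ → do
        d ← W∈
        d′ ← W′∈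
        upperBound W W′ W∈ W′∈ d d′
    where
    UpperBound : ScottOpen D → ScottOpen D → Set c
    UpperBound W W′ = ∥ ∃ (λ O → O ∈ deciding x V × W 𝒪.⊑ O × W′ 𝒪.⊑ O) ∥

    -- Once x ∈ V is known, every Scott open belongs to the family.
    union : ∀ W W′ → W ∈ deciding x V → W′ ∈ deciding x V → x ∈ subset V → UpperBound W W′
    union W W′ W∈ W′∈ x∈V =
      ⌊⌋-in (scottOpenUnion D (deciding x V) , ⌊⌋-in (inj₁ x∈V) , ub W W∈ , ub W′ W′∈)
      where ub = proj₁ (scottOpenUnion-supremum (deciding x V))

    upperBound : ∀ W W′ → W ∈ deciding x V → W′ ∈ deciding x V →
                 x ∈ subset V ⊎ ¬ x ∈ subset W → x ∈ subset V ⊎ ¬ x ∈ subset W′ →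
                 UpperBound W W′
    upperBound W W′ W∈ W′∈ (inj₁ x∈V) _          = union W W′ W∈ W′∈ x∈V
    upperBound W W′ W∈ W′∈ (inj₂ _)   (inj₁ x∈V) = union W W′ W∈ W′∈ x∈V
    upperBound W W′ _  _   (inj₂ x∉W) (inj₂ x∉W′) =
      ⌊⌋-in (exterior x , ⌊⌋-in (inj₂ (∉exterior x)) , ∉⇒⊑exterior W x∉W , ∉⇒⊑exterior W′ x∉W′)

  -- Approximate `v` twice inside `V`, by `w′ ≪ w ≪ v`. Then `↟ w` contains `v`, and sharpness at
  -- `w′ ≪ w` puts it in the family: `w′ ≪ x` forces `x ∈ V`, while `¬ w ⊑ x` keeps `x` out of
  -- `↟ w`.
  sharp⇒⊑⋃deciding : ∀ {x} → IsSharp D x → ∀ V → V 𝒪.⊑ scottOpenUnion D (deciding x V)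
  sharp⇒⊑⋃deciding {x} sharp V v v∈V = do
    (w , w≪v , w∈V) ← approximation-in-open V v∈V
    (w′ , w′≪w , w′∈V) ← approximation-in-open V w∈V
    d ← sharp w′ w w′≪w
    ⌊⌋-in (↟ w , ⌊⌋-in (decide w′∈V d) , ⌊⌋-in w≪v)
    where
    decide : ∀ {w w′} → w′ ∈ subset V → w′ ≪ x ⊎ ¬ w ⊑ x →
             x ∈ subset V ⊎ ¬ x ∈ subset (↟ w)
    decide {w′ = w′} w′∈V (inj₁ w′≪x) =
      inj₁ (proj₁ (isScottOpen V) w′ x (∈↡⇒⊑ (⌊⌋-in w′≪x)) w′∈V)
    decide _ (inj₂ w⋢x) = inj₂ (w⋢x ∘ ∈↡⇒⊑)

  sharp⇒located : ∀ {x} → IsSharp D x → IsLocated 𝒪.poset (scottOpenNeighbourhoods D x)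
  sharp⇒located {x} sharp U V U≪V = do
    (W , W∈ , U⊑W) ← U≪V (deciding x V) (scottOpenUnion D (deciding x V)) (deciding-directed x V)
      (scottOpenUnion-supremum (deciding x V)) (sharp⇒⊑⋃deciding sharp V)
    ∥∥-map (λ { (inj₁ x∈V) → inj₁ x∈V ; (inj₂ x∉W) → inj₂ (x∉W ∘ U⊑W x) }) W∈

  located⇒sharp : ∀ {x} → IsLocated 𝒪.poset (scottOpenNeighbourhoods D x) → IsSharp D x
  located⇒sharp {x} located y z y≪z = do
    (w , y≪w , w≪z) ← interpolation y≪z
    d ← located (↟ w) (↟ y) (↟-reverses-≪ y≪w)
    decide w≪z d
    where
    decide : ∀ {w} → w ≪ z → x ∈ subset (↟ y) ⊎ ¬ x ∈ subset (↟ w) → ∥ y ≪ x ⊎ ¬ z ⊑ x ∥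
    decide _ (inj₁ x∈↟y) = ∥∥-map inj₁ x∈↟y
    decide w≪z (inj₂ x∉↟w) = ⌊⌋-in (inj₂ λ z⊑x → x∉↟w (⌊⌋-in (≪-⊑-trans w≪z z⊑x)))

proposition5p13 : {c : Level} (𝕋 : TruthValues c) → let open DomainTheory 𝕋 in
    (D : Dcpo) → IsContinuous D →
    (x : Dcpo.Carrier D) →
    IsSharp D x ⇔ IsLocated (Dcpo.poset (scottOpenDcpo D)) (scottOpenNeighbourhoods D x)
proposition5p13 𝕋 D continuous x = mk⇔ sharp⇒located located⇒sharp
  where open ContinuousDcpo 𝕋 D continuous
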